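{- Let $k$ be a positive integer and let $P$ be a convex polygon belonging to $\mathcal{P}(k)$. Then any $n$-vertex graph in $P_{hom}$ has at most $n^k$ (inclusion-wise) maximal cliques.
   Context: All graphs are finite and nonempty. A polygon is a closed convex polygon in $\mathbb{R}^2$. $\mathcal{P}(k)$ is the family of all polygons $P$ for which there exist $k$ distinct lines through the origin such that every side of $P$ is parallel to one of these lines. For a finite collection $R$ of sets, its intersection graph has one vertex for each member of $R$, and two distinct vertices are adjacent iff the corresponding sets have nonempty intersection. $P_{hom}$ is the class of intersection graphs of finite collections of sets homothetic to $P$, i.e. sets obtained from $P$ by (positive) scaling and/or translation. -}

module Defs where

open import Algebra.Apartness.Bundles using (HeytingField)
open import Algebra.Bundles using (CommutativeRing)
open import Data.Fin.Base using (Fin; toℕ)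
open import Data.Fin.Subset using (Subset; _∈_; _⊆_)
open import Data.Nat.Base as ℕ using (ℕ; suc)
open import Data.Nat.DivMod using (_mod_)
open import Data.Product.Base using (Σ-syntax; ∃-syntax; _×_; _,_)
open import Data.Sum.Base using (_⊎_)
open import Function.Bundles using (_⇔_)
open import Level using (Level; _⊔_) renaming (suc to lsuc)
open import Relation.Binary.Core using (Rel)
open import Relation.Binary.Definitions using (Irreflexive; Symmetric)
open import Relation.Binary.PropositionalEquality.Core using (_≡_; _≢_)
open import Relation.Binary.Structures using (IsStrictPartialOrder)
open import Relation.Nullary.Negation.Core using (¬_)
open import Relation.Unary using (Pred; _≐_; _≬_)

record OrderedField c ℓ₁ ℓ₂ : Set (lsuc (c ⊔ ℓ₁ ⊔ ℓ₂)) where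
  infix 4 _<_ _≤_
  field
    heytingField : HeytingField c ℓ₁ ℓ₂

  open HeytingField heytingField public

  field
    _<_                  : Rel Carrier ℓ₂
    isStrictPartialOrder : IsStrictPartialOrder _≈_ _<_
    #⇔<⊎>                : ∀ {x y} → x # y ⇔ (x < y ⊎ y < x)
    +-monoˡ-<            : ∀ {x y} z → x < y → x + z < y + z
    *-pos                : ∀ {x y} → 0# < x → 0# < y → 0# < x * y

  _≤_ : Rel Carrier ℓ₂
  x ≤ y = ¬ (y < x)

  commutativeRing : CommutativeRing c ℓ₁
  commutativeRing = record { isCommutativeRing = isCommutativeRing }

  open CommutativeRing commutativeRing public
    using (+-monoid; +-commutativeMonoid)
  open import Algebra.Properties.Monoid.Mult +-monoid public
    using () renaming (_×_ to _·ℕ_)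

  Cauchy : Pred (ℕ → Carrier) (c ⊔ ℓ₂)
  Cauchy f = ∀ ε → 0# < ε → ∃[ N ] ∀ m n → N ℕ.≤ m → N ℕ.≤ n → f m < f n + ε

  ConvergesTo : (ℕ → Carrier) → Pred Carrier (c ⊔ ℓ₂)
  ConvergesTo f x =
    ∀ ε → 0# < ε → ∃[ N ] ∀ n → N ℕ.≤ n → f n < x + ε × x < f n + ε

-- The real numbers, axiomatised as a Cauchy-complete Archimedean ordered
-- field. Classically these axioms determine ℝ up to isomorphism. The order is
-- not assumed decidable.
record RealNumbers c ℓ₁ ℓ₂ : Set (lsuc (c ⊔ ℓ₁ ⊔ ℓ₂)) where
  field
    orderedField : OrderedField c ℓ₁ ℓ₂

  open OrderedField orderedField public

  field
    archimedean : ∀ x → ∃[ n ] x < n ·ℕ 1#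
    complete    : ∀ f → Cauchy f → ∃[ x ] ConvergesTo f x

module Plane {c ℓ₁ ℓ₂} (ℝ : RealNumbers c ℓ₁ ℓ₂) where
  open RealNumbers ℝ
  open import Algebra.Properties.CommutativeMonoid.Sum +-commutativeMonoid
    using (sum)

  infix  4 _≈ₚ_
  infixl 6 _+ₚ_ _-ₚ_
  infixr 7 _·ₚ_

  Point : Set c
  Point = Carrier × Carrier

  _≈ₚ_ : Rel Point ℓ₁
  (x , y) ≈ₚ (x′ , y′) = x ≈ x′ × y ≈ y′

  _+ₚ_ _-ₚ_ : Point → Point → Point
  (x , y) +ₚ (x′ , y′) = x + x′ , y + y′
  (x , y) -ₚ (x′ , y′) = x - x′ , y - y′

  _·ₚ_ : Carrier → Point → Point
  s ·ₚ (x , y) = s * x , s * y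

  cross : Point → Point → Carrier
  cross (x , y) (x′ , y′) = x * y′ - y * x′

  sumₚ : ∀ {m} → (Fin m → Point) → Point
  sumₚ p = sum (λ i → let (x , _) = p i in x) , sum (λ i → let (_ , y) = p i in y)

  ℓ : Level
  ℓ = c ⊔ ℓ₁ ⊔ ℓ₂

  ConvexHull : ∀ {m} → (Fin m → Point) → Pred Point ℓ
  ConvexHull {m} p x =
    Σ[ w ∈ (Fin m → Carrier) ]
      (∀ i → 0# ≤ w i) × sum w ≈ 1# × x ≈ₚ sumₚ (λ i → w i ·ₚ p i)

  next : ∀ {m} → Fin (suc m) → Fin (suc m)
  next {m} i = suc (toℕ i) mod suc m

  -- A nondegenerate convex polygon, given by its vertices in counterclockwise
  -- cyclic order: every vertex not on a given side lies strictly to the left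
  -- of that side. In particular the vertices are pairwise distinct and no
  -- three of them are collinear.
  record Polygon : Set (c ⊔ ℓ₂) where
    field
      size-3 : ℕ

    size : ℕ
    size = 3 ℕ.+ size-3

    field
      vertex : Fin size → Point

    side : Fin size → Point
    side i = vertex (next i) -ₚ vertex i

    field
      convex : ∀ i j → j ≢ i → j ≢ next i → 0# < cross (side i) (vertex j -ₚ vertex i)

  ⟦_⟧ : Polygon → Pred Point ℓ
  ⟦ P ⟧ = ConvexHull (Polygon.vertex P)

  -- A line through the origin, given by a nonzero direction vector.
  record Line : Set (c ⊔ ℓ₂) where
    field
      direction : Point
      nonzero   : let (x , y) = direction in x # 0# ⊎ y # 0#

  ⟦_⟧ˡ : Line → Pred Point ℓ₁
  ⟦ l ⟧ˡ x = cross (Line.direction l) x ≈ 0#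

  -- A side is parallel to a line through the origin iff its direction vector
  -- lies on that line.
  𝒫 : ℕ → Pred Polygon ℓ
  𝒫 k P =
    Σ[ l ∈ (Fin k → Line) ]
      (∀ i j → i ≢ j → ¬ (⟦ l i ⟧ˡ ≐ ⟦ l j ⟧ˡ)) ×
      (∀ i → ∃[ j ] ⟦ l j ⟧ˡ (Polygon.side P i))

  Homothetic : Pred Point ℓ → Pred (Pred Point ℓ) ℓ
  Homothetic A B =
    Σ[ s ∈ Carrier ] Σ[ t ∈ Point ]
      0# < s × B ≐ (λ x → ∃[ a ] A a × x ≈ₚ s ·ₚ a +ₚ t)

record Graph (n : ℕ) (a : Level) : Set (lsuc a) where
  field
    Adj    : Rel (Fin n) a
    sym    : Symmetric Adj
    irrefl : Irreflexive _≡_ Adj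

module _ {n a} (G : Graph n a) where
  open Graph G

  IsIntersectionGraphOf : ∀ {x ℓ} {X : Set x} → (Fin n → Pred X ℓ) → Set (a ⊔ x ⊔ ℓ)
  IsIntersectionGraphOf S = ∀ i j → i ≢ j → Adj i j ⇔ (S i ≬ S j)

  Clique : Pred (Subset n) a
  Clique C = ∀ i j → i ∈ C → j ∈ C → i ≢ j → Adj i j

  MaximalClique : Pred (Subset n) a
  MaximalClique C = Clique C × (∀ D → Clique D → C ⊆ D → C ≡ D)

module _ {c ℓ₁ ℓ₂} (ℝ : RealNumbers c ℓ₁ ℓ₂) where
  open Plane ℝ

  -- The members of the collection are indexed by the vertices of the graph.
  Pₕₒₘ : Polygon → ∀ {n a} → Pred (Graph n a) (a ⊔ lsuc ℓ)
  Pₕₒₘ P {n} G =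
    Σ[ S ∈ (Fin n → Pred Point ℓ) ]
      (∀ i → Homothetic ⟦ P ⟧ (S i)) × IsIntersectionGraphOf G S

{-# OPTIONS --safe #-}
-- Two homothetic copies of P meet iff their projections along every side
-- direction of P overlap. Indeed all copies are cut out by half-planes with the
-- same normals, and by Helly's theorem it suffices to meet any three of these
-- half-planes; two of the three belong to the same copy, which by the overlap
-- reaches into the third. So G is an intersection graph of boxes in dimension
-- k, and a maximal clique is determined by the k members whose box has the
-- largest lower end in the respective coordinate.
--
-- The order of ℝ is not decidable, but the goal is, so that all case
-- distinctions can be made under a double negation.
module Submission where

open import Defs
open import Algebra.Bundles using (CommutativeRing)
open import Algebra.Solver.Ring.AlmostCommutativeRing using (fromCommutativeRing; _-Raw-AlmostCommutative⟶_)
open import Data.Fin.Base using (Fin; zero; suc; inject₁; fromℕ; toℕ; combine; remQuot; funToFin; finToFun)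
open import Data.Fin.Patterns using (0F; 1F)
open import Data.Fin.Properties
  using (_≟_; remQuot-combine; toℕ-fromℕ; toℕ-fromℕ<; toℕ-injective; toℕ-inject₁; toℕ<n; finToFun-funToFin; injective⇒≤)
open import Data.Fin.Subset using (Subset; inside; outside; _∈_; _∪_; ⊤; ⁅_⁆; Nonempty)
open import Data.Fin.Subset.Properties using (nonempty?; p⊆p∪q; q⊆p∪q; x∈p∪q⁻; x∈⁅x⁆; x∈⁅y⁆⇒x≡y; ∈⊤)
open import Data.Integer.Base as ℤ using (ℤ; +_; -[1+_]; _⊖_; _◃_)
import Data.Integer.Properties as ℤ
open import Data.List.Base using (List; length; lookup)
open import Data.List.Membership.Propositional.Properties using (∈-lookup)
open import Data.List.Relation.Unary.All as All using (All)
open import Data.List.Relation.Unary.AllPairs using (_∷_)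
open import Data.List.Relation.Unary.Unique.Propositional using (Unique)
open import Data.Maybe.Base using (Maybe; just; nothing)
open import Data.Nat.Base as ℕ using (ℕ)
open import Data.Nat.DivMod using (m<n⇒m%n≡m; m%n<n; n%n≡0)
import Data.Nat.Properties as ℕ
open import Data.Product.Base using (∃-syntax; _×_; _,_; proj₁; proj₂; uncurry)
import Data.Sign.Base as Sign
open import Data.Sum.Base using (_⊎_; inj₁; inj₂; [_,_]′)
open import Data.Vec.Base using (_∷_; here; there)
open import Function.Bundles using (module Equivalence)
open import Level using (Level)
open import Relation.Binary.PropositionalEquality.Core as ≡ using (_≡_; _≢_)
open import Relation.Binary.Structures using (IsStrictPartialOrder)
open import Relation.Nullary.Decidable.Core using (Dec; yes; no; ¬¬-excluded-middle; decidable-stable)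
open import Relation.Nullary.Negation.Core using (¬_; contradiction; ¬¬-map)
open import Relation.Unary using (_≬_)

-- Classical reasoning under double negation.

private
  variable
    lᴬ lᴮ : Level
    A : Set lᴬ
    B : Set lᴮ

  infixl 1 _>>=_
  -- The result is an arbitrary negation `¬ B`. As `x ≤ y` unfolds to a negation, a `do` block can
  -- prove an inequality as well as a doubly negated goal.
  _>>=_ : ¬ ¬ A → (A → ¬ B) → ¬ B
  (m >>= k) b = m λ a → k a b

  return : A → ¬ ¬ A
  return a ¬a = ¬a a

  em : (A : Set lᴬ) → ¬ ¬ Dec A
  em A = ¬¬-excluded-middle

-- Double negation commutes with a quantifier over a finite index set, by induction on its size.
-- This makes finitely many classical choices at once.
¬¬-sequence : ∀ {n} {P : Fin n → Set lᴬ} → (∀ i → ¬ ¬ P i) → ¬ ¬ (∀ i → P i)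
¬¬-sequence {n = ℕ.zero}  h = return λ ()
¬¬-sequence {n = ℕ.suc n} h = do
  p₀ ← h zero
  ps ← ¬¬-sequence λ i → h (suc i)
  return λ { zero → p₀ ; (suc i) → ps i }

-- Ring identities with integer coefficients.

module IntegerSolver {c ℓ} (R : CommutativeRing c ℓ) where
  open CommutativeRing R
  open import Algebra.Properties.Ring ring
  open import Algebra.Properties.Semiring.Mult.TCOptimised semiring
    using (×-homo-+; ×1-homo-*; 1+×) renaming (_×_ to _×ᴿ_)
  open import Algebra.Properties.AbelianGroup +-abelianGroup using (⁻¹-∙-comm)
  open import Relation.Binary.Reasoning.Setoid setoid

  private
    -- With this version of the multiple, `1 ×ᴿ 1#` reduces to `1#`, so the solver constant
    -- `con (+ 1)` denotes exactly `1#`.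
    nat→R : ℕ → Carrier
    nat→R n = n ×ᴿ 1#

    int→R : ℤ → Carrier
    int→R (+ n)    = nat→R n
    int→R -[1+ n ] = - nat→R (ℕ.suc n)

    cancel : ∀ x y z → (x + y) - (x + z) ≈ y - z
    cancel x y z = begin
      (x + y) - (x + z)       ≈⟨ +-cong (+-comm x y) (sym (⁻¹-∙-comm x z)) ⟩
      (y + x) + (- x + - z)   ≈⟨ +-assoc y x _ ⟩
      y + (x + (- x + - z))   ≈⟨ +-congˡ (sym (+-assoc x (- x) (- z))) ⟩
      y + ((x - x) + - z)     ≈⟨ +-congˡ (+-congʳ (-‿inverseʳ x)) ⟩
      y + (0# + - z)          ≈⟨ +-congˡ (+-identityˡ _) ⟩
      y - z                   ∎

    ⊖-homo : ∀ m n → int→R (m ⊖ n) ≈ nat→R m - nat→R n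
    ⊖-homo m ℕ.zero            = sym (trans (+-congˡ -0#≈0#) (+-identityʳ _))
    ⊖-homo ℕ.zero (ℕ.suc n)    = sym (+-identityˡ _)
    ⊖-homo (ℕ.suc m) (ℕ.suc n) = begin
      int→R (ℕ.suc m ⊖ ℕ.suc n)          ≡⟨ ≡.cong int→R (ℤ.[1+m]⊖[1+n]≡m⊖n m n) ⟩
      int→R (m ⊖ n)                      ≈⟨ ⊖-homo m n ⟩
      nat→R m - nat→R n                  ≈⟨ cancel 1# _ _ ⟨
      (1# + nat→R m) - (1# + nat→R n)    ≈⟨ +-cong (1+× m 1#) (-‿cong (1+× n 1#)) ⟨
      nat→R (ℕ.suc m) - nat→R (ℕ.suc n)  ∎

    +-homo : ∀ i j → int→R (i ℤ.+ j) ≈ int→R i + int→R j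
    +-homo (+ m)    (+ n)    = ×-homo-+ 1# m n
    +-homo (+ m)    -[1+ n ] = ⊖-homo m (ℕ.suc n)
    +-homo -[1+ m ] (+ n)    = trans (⊖-homo n (ℕ.suc m)) (+-comm _ _)
    +-homo -[1+ m ] -[1+ n ] = begin
      - nat→R (ℕ.suc (ℕ.suc (m ℕ.+ n)))          ≈⟨ -‿cong (1+× (ℕ.suc (m ℕ.+ n)) 1#) ⟩
      - (1# + nat→R (ℕ.suc m ℕ.+ n))             ≈⟨ -‿cong (+-congˡ (×-homo-+ 1# (ℕ.suc m) n)) ⟩
      - (1# + (nat→R (ℕ.suc m) + nat→R n))       ≈⟨ -‿cong (+-assoc _ _ _) ⟨
      - (1# + nat→R (ℕ.suc m) + nat→R n)         ≈⟨ -‿cong (+-congʳ (+-comm _ _)) ⟩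
      - (nat→R (ℕ.suc m) + 1# + nat→R n)         ≈⟨ -‿cong (+-assoc _ _ _) ⟩
      - (nat→R (ℕ.suc m) + (1# + nat→R n))       ≈⟨ -‿cong (+-congˡ (1+× n 1#)) ⟨
      - (nat→R (ℕ.suc m) + nat→R (ℕ.suc n))      ≈⟨ ⁻¹-∙-comm _ _ ⟨
      - nat→R (ℕ.suc m) - nat→R (ℕ.suc n)        ∎

    +◃-homo : ∀ n → int→R (Sign.+ ◃ n) ≈ nat→R n
    +◃-homo ℕ.zero    = refl
    +◃-homo (ℕ.suc n) = refl

    -◃-homo : ∀ n → int→R (Sign.- ◃ n) ≈ - nat→R n
    -◃-homo ℕ.zero    = sym -0#≈0#
    -◃-homo (ℕ.suc n) = refl

    *-homo : ∀ i j → int→R (i ℤ.* j) ≈ int→R i * int→R j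
    *-homo (+ m)    (+ n)    = trans (+◃-homo (m ℕ.* n)) (×1-homo-* m n)
    *-homo (+ m)    -[1+ n ] = begin
      int→R (Sign.- ◃ (m ℕ.* ℕ.suc n))  ≈⟨ -◃-homo (m ℕ.* ℕ.suc n) ⟩
      - nat→R (m ℕ.* ℕ.suc n)           ≈⟨ -‿cong (×1-homo-* m (ℕ.suc n)) ⟩
      - (nat→R m * nat→R (ℕ.suc n))     ≈⟨ -‿distribʳ-* _ _ ⟩
      nat→R m * - nat→R (ℕ.suc n)       ∎
    *-homo -[1+ m ] (+ n)    = begin
      int→R (Sign.- ◃ (ℕ.suc m ℕ.* n))  ≈⟨ -◃-homo (ℕ.suc m ℕ.* n) ⟩
      - nat→R (ℕ.suc m ℕ.* n)           ≈⟨ -‿cong (×1-homo-* (ℕ.suc m) n) ⟩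
      - (nat→R (ℕ.suc m) * nat→R n)     ≈⟨ -‿distribˡ-* _ _ ⟩
      - nat→R (ℕ.suc m) * nat→R n       ∎
    *-homo -[1+ m ] -[1+ n ] = begin
      nat→R (ℕ.suc m ℕ.* ℕ.suc n)                ≈⟨ ×1-homo-* (ℕ.suc m) (ℕ.suc n) ⟩
      nat→R (ℕ.suc m) * nat→R (ℕ.suc n)          ≈⟨ -‿involutive _ ⟨
      - - (nat→R (ℕ.suc m) * nat→R (ℕ.suc n))    ≈⟨ -‿cong (-‿distribˡ-* _ _) ⟩
      - (- nat→R (ℕ.suc m) * nat→R (ℕ.suc n))    ≈⟨ -‿distribʳ-* _ _ ⟩
      - nat→R (ℕ.suc m) * - nat→R (ℕ.suc n)      ∎

    -‿homo : ∀ i → int→R (ℤ.- i) ≈ - int→R i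
    -‿homo (+ ℕ.zero)  = sym -0#≈0#
    -‿homo (+ ℕ.suc n) = refl
    -‿homo -[1+ n ]    = sym (-‿involutive _)

    -- Equality in the ring need not be decidable, so the solver computes with coefficients in ℤ,
    -- where they can be compared.
    homomorphism : ℤ.+-*-rawRing -Raw-AlmostCommutative⟶ fromCommutativeRing R
    homomorphism = record
      { ⟦_⟧    = int→R
      ; +-homo = +-homo
      ; *-homo = *-homo
      ; -‿homo = -‿homo
      ; 0-homo = refl
      ; 1-homo = refl
      }

    int→R≟ : ∀ i j → Maybe (int→R i ≈ int→R j)
    int→R≟ i j with i ℤ.≟ j
    ... | yes ≡.refl = just refl
    ... | no _       = nothing

  open import Algebra.Solver.Ring _ _ homomorphism int→R≟ public

-- Ordered-field arithmetic and Helly's theorem on the line.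

module OrderedFieldProperties {c ℓ₁ ℓ₂} (F : OrderedField c ℓ₁ ℓ₂) where
  open OrderedField F hiding (zero)
  open IsStrictPartialOrder isStrictPartialOrder public
    using (<-respʳ-≈; <-respˡ-≈) renaming (irrefl to <-irrefl; trans to <-trans)
  open IntegerSolver commutativeRing using (solve; _:=_; _:+_; _:-_; :-_; _:*_; con)

  0≤-resp-≈ : ∀ {x y} → x ≈ y → 0# ≤ x → 0# ≤ y
  0≤-resp-≈ x≈y 0≤x y<0 = 0≤x (<-respˡ-≈ (sym x≈y) y<0)

  <⇒≤ : ∀ {x y} → x < y → x ≤ y
  <⇒≤ x<y y<x = <-irrefl refl (<-trans x<y y<x)

  ≈⇒≤ : ∀ {x y} → x ≈ y → x ≤ y
  ≈⇒≤ x≈y = <-irrefl (sym x≈y)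

  x<y⇒0<y-x : ∀ {x y} → x < y → 0# < y - x
  x<y⇒0<y-x {x} {y} x<y = <-respˡ-≈ (-‿inverseʳ x) (+-monoˡ-< (- x) x<y)

  x<0⇒0<-x : ∀ {x} → x < 0# → 0# < - x
  x<0⇒0<-x x<0 = <-respʳ-≈ (+-identityˡ _) (x<y⇒0<y-x x<0)

  0<y-x⇒x<y : ∀ {x y} → 0# < y - x → x < y
  0<y-x⇒x<y {x} {y} 0<y-x = <-respˡ-≈ (+-identityˡ x)
    (<-respʳ-≈ (solve 2 (λ x y → (y :- x) :+ x := y) refl x y) (+-monoˡ-< x 0<y-x))

  x≤y⇒0≤y-x : ∀ {x y} → x ≤ y → 0# ≤ y - x
  x≤y⇒0≤y-x {x} {y} x≤y y-x<0 = x≤y (0<y-x⇒x<y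
    (<-respʳ-≈ (solve 2 (λ x y → :- (y :- x) := x :- y) refl x y) (x<0⇒0<-x y-x<0)))

  0≤y-x⇒x≤y : ∀ {x y} → 0# ≤ y - x → x ≤ y
  0≤y-x⇒x≤y {x} {y} 0≤y-x y<x = 0≤y-x (<-respʳ-≈ (-‿inverseʳ x) (+-monoˡ-< (- x) y<x))

  ≤-<-connex : ∀ x y → ¬ ¬ (x ≤ y ⊎ y < x)
  ≤-<-connex x y = do
    yes y<x ← em (y < x)
      where no y≮x → return (inj₁ y≮x)
    return (inj₂ y<x)

  ¬#⇒≈ : ∀ {x y} → ¬ x # y → x ≈ y
  ¬#⇒≈ {x} {y} = proj₁ (tight x y)

  -- By tightness: if neither `x < y` nor `y < x`, the two are not apart, hence equal.
  ≤⇒<∨≈ : ∀ {x y} → x ≤ y → ¬ ¬ (x < y ⊎ x ≈ y)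
  ≤⇒<∨≈ {x} {y} x≤y = do
    no x≮y ← em (x < y)
      where yes x<y → return (inj₁ x<y)
    return (inj₂ (¬#⇒≈ λ x#y → [ x≮y , x≤y ]′ (Equivalence.to #⇔<⊎> x#y)))

  0≤x+y : ∀ {x y} → 0# ≤ x → 0# ≤ y → 0# ≤ x + y
  0≤x+y {x} {y} 0≤x 0≤y = do
    inj₁ 0<x ← ≤⇒<∨≈ 0≤x
      where inj₂ 0≈x → 0≤-resp-≈ (trans (sym (+-identityˡ y)) (+-congʳ 0≈x)) 0≤y
    inj₁ 0<y ← ≤⇒<∨≈ 0≤y
      where inj₂ 0≈y → 0≤-resp-≈ (trans (sym (+-identityʳ x)) (+-congˡ 0≈y)) 0≤x
    <⇒≤ (<-trans 0<y (<-respˡ-≈ (+-identityˡ y) (+-monoˡ-< y 0<x)))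

  0≤x*y : ∀ {x y} → 0# ≤ x → 0# ≤ y → 0# ≤ x * y
  0≤x*y {x} {y} 0≤x 0≤y = do
    inj₁ 0<x ← ≤⇒<∨≈ 0≤x
      where inj₂ 0≈x → ≈⇒≤ (trans (sym (zeroˡ y)) (*-congʳ 0≈x))
    inj₁ 0<y ← ≤⇒<∨≈ 0≤y
      where inj₂ 0≈y → ≈⇒≤ (trans (sym (zeroʳ x)) (*-congˡ 0≈y))
    <⇒≤ (*-pos 0<x 0<y)

  ≤-trans : ∀ {x y z} → x ≤ y → y ≤ z → x ≤ z
  ≤-trans {x} {y} {z} x≤y y≤z = 0≤y-x⇒x≤y
    (0≤-resp-≈ (solve 3 (λ x y z → (y :- x) :+ (z :- y) := z :- x) refl x y z)
      (0≤x+y (x≤y⇒0≤y-x x≤y) (x≤y⇒0≤y-x y≤z)))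

  0≤x*x : ∀ x → 0# ≤ x * x
  0≤x*x x = do
    inj₁ 0≤x ← ≤-<-connex 0# x
      where inj₂ x<0 → 0≤-resp-≈ (solve 1 (λ x → (:- x) :* (:- x) := x :* x) refl x)
                          (<⇒≤ (*-pos (x<0⇒0<-x x<0) (x<0⇒0<-x x<0)))
    0≤x*y 0≤x 0≤x

  0≤1 : 0# ≤ 1#
  0≤1 = 0≤-resp-≈ (*-identityˡ 1#) (0≤x*x 1#)

  x#0⇒invertible : ∀ {x} → x # 0# → ∃[ y ] x * y ≈ 1#
  -- The field axiom inverts the difference `x - 0#`; the zero is removed afterwards.
  x#0⇒invertible {x} x#0 with y , _ , eq ← #⇒invertible x#0 =
    y , trans (solve 2 (λ x y → x :* y := (x :- con (+ 0)) :* y) refl x y) eq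

  -- If x y = 1 with x ≥ 0, then y = x y² ≥ 0.
  inverse-nonneg : ∀ {x y} → 0# ≤ x → x * y ≈ 1# → 0# ≤ y
  inverse-nonneg {x} {y} 0≤x xy≈1 = 0≤-resp-≈
    (trans (solve 2 (λ x y → x :* (y :* y) := (x :* y) :* y) refl x y)
      (trans (*-congʳ xy≈1) (*-identityˡ y)))
    (0≤x*y 0≤x (0≤x*x y))

  neg-cancel-≤ : ∀ {x y} → - x ≤ - y → y ≤ x
  neg-cancel-≤ {x} {y} -x≤-y = 0≤y-x⇒x≤y
    (0≤-resp-≈ (solve 2 (λ x y → (:- y) :- (:- x) := x :- y) refl x y) (x≤y⇒0≤y-x -x≤-y))

  positive-inverse : ∀ {x} → 0# < x → ∃[ y ] 0# ≤ y × x * y ≈ 1#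
  positive-inverse 0<x with y , xy≈1 ← x#0⇒invertible (Equivalence.from #⇔<⊎> (inj₂ 0<x)) =
    y , inverse-nonneg (<⇒≤ 0<x) xy≈1 , xy≈1

  -- Turns an equation with a linear certificate for its dependence on p ≈ q
  -- into a ring identity.
  modulo : ∀ {p q x y} k → p ≈ q → x ≈ y + k * (p - q) → x ≈ y
  modulo {p} {q} {x} {y} k p≈q eq = begin
    x                ≈⟨ eq ⟩
    y + k * (p - q)  ≈⟨ +-congˡ (*-congˡ (+-congʳ p≈q)) ⟩
    y + k * (q - q)  ≈⟨ solve 3 (λ y k q → y :+ k :* (q :- q) := y) refl y k q ⟩
    y                ∎
    where open import Relation.Binary.Reasoning.Setoid setoid

  -- The strict order is not a negation, so a doubly negated case split cannot reach it.
  -- Cotransitivity of `#` gives a direct split: `z` is apart from `x` or from `y`.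
  <-≤-trans : ∀ {x y z} → x < y → y ≤ z → x < z
  <-≤-trans {x} {y} {z} x<y y≤z with #-cotrans (Equivalence.from #⇔<⊎> (inj₁ x<y)) z
  ... | inj₁ x#z = [ (λ x<z → x<z) , (λ z<x → contradiction (<-trans z<x x<y) y≤z) ]′
                     (Equivalence.to #⇔<⊎> x#z)
  ... | inj₂ z#y = [ (λ z<y → contradiction z<y y≤z) , (λ y<z → <-trans x<y y<z) ]′
                     (Equivalence.to #⇔<⊎> z#y)

  0≤x*y⇒0≤y : ∀ {x y} → 0# < x → 0# ≤ x * y → 0# ≤ y
  0≤x*y⇒0≤y {x} {y} 0<x 0≤xy with b , 0≤b , xb≈1 ← positive-inverse 0<x =
    0≤-resp-≈
      (modulo y xb≈1 (solve 3 (λ x y b → b :* (x :* y) := y :+ y :* (x :* b :- con (+ 1))) refl x y b))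
      (0≤x*y 0≤b 0≤xy)

  -- If f₀ p < 0, replacing p by the zero of f₀ keeps every other constraint:
  -- each fᵢ is nonnegative at p and at some q with f₀ q ≥ 0, and this zero
  -- lies between p and q.
  helly₁ : ∀ {m} (a b : Fin m → Carrier) →
    (∀ i j → ¬ ¬ (∃[ t ] 0# ≤ a i + b i * t × 0# ≤ a j + b j * t)) →
    ¬ ¬ (∃[ t ] ∀ i → 0# ≤ a i + b i * t)
  helly₁ {ℕ.zero}  a b pairs = return (0# , λ ())
  helly₁ {ℕ.suc m} a b pairs = do
    (p , fᵢp≥0) ← helly₁ (λ i → a (suc i)) (λ i → b (suc i)) (λ i j → pairs (suc i) (suc j))
    inj₂ f₀p<0 ← ≤-<-connex 0# (f zero p)
      where inj₁ f₀p≥0 → return (p , λ { zero → f₀p≥0 ; (suc i) → fᵢp≥0 i })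
    yes b₀#0 ← em (b zero # 0#)
      where
        no b₀¬#0 → do
          -- The diagonal pair gives a point where the first constraint holds; a constant function
          -- cannot be nonnegative there and negative at `p`.
          (q , f₀q≥0 , _) ← pairs zero zero
          contradiction (<-respˡ-≈ (constant (¬#⇒≈ b₀¬#0) q p) f₀p<0) f₀q≥0
    let (c , b₀c≈1) = x#0⇒invertible b₀#0
        r           = - (a zero * c)
        f₀r≈0 : f zero r ≈ 0#
        f₀r≈0       = modulo (- a zero) b₀c≈1
          (solve 3 (λ a b c → a :+ b :* (:- (a :* c)) := con (+ 0) :+ (:- a) :* (b :* c :- con (+ 1)))
            refl (a zero) (b zero) c)
    return (r , λ
      { zero    → ≈⇒≤ (sym f₀r≈0)
      ; (suc i) → do
          (q , f₀q≥0 , fᵢq≥0) ← pairs zero (suc i)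
          0≤x*y⇒0≤y
            (x<y⇒0<y-x (<-≤-trans f₀p<0 f₀q≥0))
            (0≤-resp-≈ (sym (crossing (suc i) f₀r≈0))
              (0≤x+y (0≤x*y f₀q≥0 (fᵢp≥0 i)) (0≤x*y (<⇒≤ (x<0⇒0<-x f₀p<0)) fᵢq≥0)))
      })
    where
    f : Fin (ℕ.suc m) → Carrier → Carrier
    f i t = a i + b i * t

    constant : b zero ≈ 0# → ∀ q p → f zero p ≈ f zero q
    constant b₀≈0 q p = modulo (p - q) b₀≈0
      (solve 4 (λ a b p q → a :+ b :* p := (a :+ b :* q) :+ (p :- q) :* (b :- con (+ 0)))
        refl (a zero) (b zero) p q)

    -- The zero `r` of `f zero` is the average of `p` and `q` with weights proportional to
    -- `f zero q` and `- f zero p`, and the affine function `f i` respects weighted averages.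
    crossing : ∀ i {p q r} → f zero r ≈ 0# →
      (f zero q - f zero p) * f i r ≈ f zero q * f i p + (- f zero p) * f i q
    crossing i {p} {q} {r} f₀r≈0 = modulo (b i * (q - p)) f₀r≈0
      (solve 7 (λ a₀ b₀ aᵢ bᵢ p q r →
          let f₀ = λ t → a₀ :+ b₀ :* t
              fᵢ = λ t → aᵢ :+ bᵢ :* t
          in (f₀ q :- f₀ p) :* fᵢ r
             := (f₀ q :* fᵢ p :+ (:- f₀ p) :* fᵢ q) :+ (bᵢ :* (q :- p)) :* (f₀ r :- con (+ 0)))
        refl (a zero) (b zero) (a i) (b i) p q r)

-- Cross products, half-planes and Helly's theorem in the plane.

module PlaneProperties {c ℓ₁ ℓ₂} (ℝ : RealNumbers c ℓ₁ ℓ₂) where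
  open Plane ℝ
  open RealNumbers ℝ hiding (zero)
  open OrderedFieldProperties orderedField
  open IntegerSolver commutativeRing using (Polynomial; solve; _:=_; _:+_; _:-_; :-_; _:*_; con)

  :cross : ∀ {n} (u₁ u₂ v₁ v₂ : Polynomial n) → Polynomial n
  :cross u₁ u₂ v₁ v₂ = u₁ :* v₂ :- u₂ :* v₁

  cross-congʳ : ∀ u {x y} → x ≈ₚ y → cross u x ≈ cross u y
  cross-congʳ (u₁ , u₂) (x₁≈y₁ , x₂≈y₂) = +-cong (*-congˡ x₂≈y₂) (-‿cong (*-congˡ x₁≈y₁))

  cross-congˡ : ∀ {u v} x → u ≈ₚ v → cross u x ≈ cross v x
  cross-congˡ (x₁ , x₂) (u₁≈v₁ , u₂≈v₂) = +-cong (*-congʳ u₁≈v₁) (-‿cong (*-congʳ u₂≈v₂))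

  cross-+ : ∀ u x y → cross u (x +ₚ y) ≈ cross u x + cross u y
  cross-+ (u₁ , u₂) (x₁ , x₂) (y₁ , y₂) = solve 6 (λ u₁ u₂ x₁ x₂ y₁ y₂ →
    :cross u₁ u₂ (x₁ :+ y₁) (x₂ :+ y₂) := :cross u₁ u₂ x₁ x₂ :+ :cross u₁ u₂ y₁ y₂)
    refl u₁ u₂ x₁ x₂ y₁ y₂

  cross-- : ∀ u x y → cross u (x -ₚ y) ≈ cross u x - cross u y
  cross-- (u₁ , u₂) (x₁ , x₂) (y₁ , y₂) = solve 6 (λ u₁ u₂ x₁ x₂ y₁ y₂ →
    :cross u₁ u₂ (x₁ :- y₁) (x₂ :- y₂) := :cross u₁ u₂ x₁ x₂ :- :cross u₁ u₂ y₁ y₂)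
    refl u₁ u₂ x₁ x₂ y₁ y₂

  cross-·ʳ : ∀ u t x → cross u (t ·ₚ x) ≈ t * cross u x
  cross-·ʳ (u₁ , u₂) t (x₁ , x₂) = solve 5 (λ u₁ u₂ t x₁ x₂ →
    :cross u₁ u₂ (t :* x₁) (t :* x₂) := t :* :cross u₁ u₂ x₁ x₂)
    refl u₁ u₂ t x₁ x₂

  cross-·ˡ : ∀ t u x → cross (t ·ₚ u) x ≈ t * cross u x
  cross-·ˡ t (u₁ , u₂) (x₁ , x₂) = solve 5 (λ u₁ u₂ t x₁ x₂ →
    :cross (t :* u₁) (t :* u₂) x₁ x₂ := t :* :cross u₁ u₂ x₁ x₂)
    refl u₁ u₂ t x₁ x₂

  cross-self : ∀ u → cross u u ≈ 0#
  cross-self (u₁ , u₂) = solve 2 (λ u₁ u₂ → :cross u₁ u₂ u₁ u₂ := con (+ 0)) refl u₁ u₂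

  -ₚ-telescope : ∀ x y z → (x -ₚ z) ≈ₚ (x -ₚ y) +ₚ (y -ₚ z)
  -ₚ-telescope (x₁ , x₂) (y₁ , y₂) (z₁ , z₂) = lemma x₁ y₁ z₁ , lemma x₂ y₂ z₂
    where
    lemma : ∀ x y z → x - z ≈ (x - y) + (y - z)
    lemma = solve 3 (λ x y z → x :- z := (x :- y) :+ (y :- z)) refl

  +ₚ--ₚ-cancel : ∀ x y → ((x +ₚ y) -ₚ x) ≈ₚ y
  +ₚ--ₚ-cancel (x₁ , x₂) (y₁ , y₂) = lemma x₁ y₁ , lemma x₂ y₂
    where
    lemma : ∀ x y → x + y - x ≈ y
    lemma = solve 2 (λ x y → x :+ y :- x := y) refl

  -- The weights `b * G` and `- (b * H)` of `p` and `q` add up to one, so subtracting `w` from the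
  -- average amounts to subtracting it from both points.
  cross-weighted : ∀ u w p q {b G H} → (G - H) * b ≈ 1# →
    cross u (b ·ₚ (G ·ₚ p -ₚ H ·ₚ q) -ₚ w)
    ≈ b * (G * cross u (p -ₚ w) + (- H) * cross u (q -ₚ w))
  cross-weighted u w p q {b} {G} {H} Db≈1 = begin
    cross u (b ·ₚ (G ·ₚ p -ₚ H ·ₚ q) -ₚ w)
      ≈⟨ cross-congʳ u (lemma _ _ _ , lemma _ _ _) ⟩
    cross u (b ·ₚ (G ·ₚ (p -ₚ w) +ₚ (- H) ·ₚ (q -ₚ w)))
      ≈⟨ cross-·ʳ u b _ ⟩
    b * cross u (G ·ₚ (p -ₚ w) +ₚ (- H) ·ₚ (q -ₚ w))
      ≈⟨ *-congˡ (cross-+ u _ _) ⟩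
    b * (cross u (G ·ₚ (p -ₚ w)) + cross u ((- H) ·ₚ (q -ₚ w)))
      ≈⟨ *-congˡ (+-cong (cross-·ʳ u G _) (cross-·ʳ u (- H) _)) ⟩
    b * (G * cross u (p -ₚ w) + (- H) * cross u (q -ₚ w)) ∎
    where
    open import Relation.Binary.Reasoning.Setoid setoid

    lemma : ∀ p q w → b * (G * p - H * q) - w ≈ b * (G * (p - w) + (- H) * (q - w))
    lemma p q w = modulo w Db≈1 (solve 6 (λ b G H p q w →
      b :* (G :* p :- H :* q) :- w
      := b :* (G :* (p :- w) :+ (:- H) :* (q :- w)) :+ w :* ((G :- H) :* b :- con (+ 1)))
      refl b G H p q w)

  NonZeroₚ : Point → Set ℓ₂
  NonZeroₚ (x , y) = x # 0# ⊎ y # 0#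

  -- The factor is the quotient of the coordinates in which `u` is invertible; the vanishing cross
  -- product settles the other coordinate.
  cross-≈0⇒parallel : ∀ u v → NonZeroₚ u → cross u v ≈ 0# → ∃[ t ] v ≈ₚ t ·ₚ u
  cross-≈0⇒parallel (u₁ , u₂) (v₁ , v₂) (inj₁ u₁#0) u×v≈0 with b , u₁b≈1 ← x#0⇒invertible u₁#0 =
    v₁ * b ,
    modulo (- v₁) u₁b≈1
      (solve 3 (λ u₁ v₁ b → v₁ := v₁ :* b :* u₁ :+ (:- v₁) :* (u₁ :* b :- con (+ 1))) refl u₁ v₁ b) ,
    modulo b u×v≈0 (modulo (- v₂) u₁b≈1
      (solve 5 (λ u₁ u₂ v₁ v₂ b →
          v₂ := (v₁ :* b :* u₂ :+ b :* (:cross u₁ u₂ v₁ v₂ :- con (+ 0))) :+ (:- v₂) :* (u₁ :* b :- con (+ 1)))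
        refl u₁ u₂ v₁ v₂ b))
  cross-≈0⇒parallel (u₁ , u₂) (v₁ , v₂) (inj₂ u₂#0) u×v≈0 with b , u₂b≈1 ← x#0⇒invertible u₂#0 =
    v₂ * b ,
    modulo (- b) u×v≈0 (modulo (- v₁) u₂b≈1
      (solve 5 (λ u₁ u₂ v₁ v₂ b →
          v₁ := (v₂ :* b :* u₁ :+ (:- b) :* (:cross u₁ u₂ v₁ v₂ :- con (+ 0))) :+ (:- v₁) :* (u₂ :* b :- con (+ 1)))
        refl u₁ u₂ v₁ v₂ b)) ,
    modulo (- v₂) u₂b≈1
      (solve 3 (λ u₂ v₂ b → v₂ := v₂ :* b :* u₂ :+ (:- v₂) :* (u₂ :* b :- con (+ 1))) refl u₂ v₂ b)

  -- If no coordinate of `u` were apart from zero, tightness would make `u` and hence the cross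
  -- product zero.
  cross-<0⇒nonZero : ∀ u v → cross u v < 0# → ¬ ¬ NonZeroₚ u
  cross-<0⇒nonZero (u₁ , u₂) (v₁ , v₂) u×v<0 ¬nz = <-irrefl
    (modulo v₂ (¬#⇒≈ λ u₁#0 → ¬nz (inj₁ u₁#0)) (modulo (- v₁) (¬#⇒≈ λ u₂#0 → ¬nz (inj₂ u₂#0))
      (solve 4 (λ u₁ u₂ v₁ v₂ → :cross u₁ u₂ v₁ v₂
          := (con (+ 0) :+ v₂ :* (u₁ :- con (+ 0))) :+ (:- v₁) :* (u₂ :- con (+ 0)))
        refl u₁ u₂ v₁ v₂)))
    u×v<0

  -- The closed half-plane bounded by the line through z with direction u.
  Left : Point → Point → Point → Set ℓ₂
  Left z u x = 0# ≤ cross u (x -ₚ z)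

  -- Restricted to a parametrised line, a half-plane becomes an affine constraint on `t`, in the
  -- form that `helly₁` expects.
  cross-on-line : ∀ u z z₀ u₀ {r t} → (r -ₚ z₀) ≈ₚ t ·ₚ u₀ →
    cross u (r -ₚ z) ≈ cross u (z₀ -ₚ z) + cross u u₀ * t
  cross-on-line u z z₀ u₀ {r} {t} r-z₀≈tu₀ = begin
    cross u (r -ₚ z)                            ≈⟨ cross-congʳ u (-ₚ-telescope r z₀ z) ⟩
    cross u ((r -ₚ z₀) +ₚ (z₀ -ₚ z))            ≈⟨ cross-+ u _ _ ⟩
    cross u (r -ₚ z₀) + cross u (z₀ -ₚ z)       ≈⟨ +-comm _ _ ⟩
    cross u (z₀ -ₚ z) + cross u (r -ₚ z₀)       ≈⟨ +-congˡ (cross-congʳ u r-z₀≈tu₀) ⟩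
    cross u (z₀ -ₚ z) + cross u (t ·ₚ u₀)       ≈⟨ +-congˡ (cross-·ʳ u t u₀) ⟩
    cross u (z₀ -ₚ z) + t * cross u u₀          ≈⟨ +-congˡ (*-comm t _) ⟩
    cross u (z₀ -ₚ z) + cross u u₀ * t          ∎
    where open import Relation.Binary.Reasoning.Setoid setoid

  line-left : ∀ z₀ u₀ t z u → 0# ≤ cross u (z₀ -ₚ z) + cross u u₀ * t →
    Left z u (z₀ +ₚ t ·ₚ u₀)
  line-left z₀ u₀ t z u = 0≤-resp-≈ (sym (cross-on-line u z z₀ u₀ (+ₚ--ₚ-cancel z₀ (t ·ₚ u₀))))

  line-left-self : ∀ z₀ u₀ t → Left z₀ u₀ (z₀ +ₚ t ·ₚ u₀)
  line-left-self z₀ u₀ t = ≈⇒≤ (sym (trans (cross-congʳ u₀ (+ₚ--ₚ-cancel z₀ (t ·ₚ u₀)))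
    (trans (cross-·ʳ u₀ t u₀) (trans (*-congˡ (cross-self u₀)) (zeroʳ t)))))

  -- z₀ + t u₀ is the point where the segment from p to q crosses the line.
  crossing-point : ∀ z₀ u₀ p q → NonZeroₚ u₀ → cross u₀ (p -ₚ z₀) < 0# → Left z₀ u₀ q →
    ∃[ t ] ∀ z u → Left z u p → Left z u q → 0# ≤ cross u (z₀ -ₚ z) + cross u u₀ * t
  crossing-point z₀ u₀ p q u₀≠0 H<0 0≤G =
    proj₁ r-on-line , λ z u 0≤p 0≤q → 0≤-resp-≈
      (trans (sym (cross-weighted u z p q Db≈1)) (cross-on-line u z z₀ u₀ (proj₂ r-on-line)))
      (0≤x*y 0≤b (0≤x+y (0≤x*y 0≤G 0≤p) (0≤x*y (<⇒≤ (x<0⇒0<-x H<0)) 0≤q)))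
    where
    G = cross u₀ (q -ₚ z₀)
    H = cross u₀ (p -ₚ z₀)

    inverse = positive-inverse (x<y⇒0<y-x (<-≤-trans H<0 0≤G))
    b       = proj₁ inverse
    0≤b     = proj₁ (proj₂ inverse)
    Db≈1    = proj₂ (proj₂ inverse)

    -- `G` and `H` measure `q` and `p` against the line. Weighting each point by the opposite value
    -- cancels them at `r`, and `H < 0 ≤ G` makes both weights nonnegative.
    r : Point
    r = b ·ₚ (G ·ₚ p -ₚ H ·ₚ q)

    cancel : ∀ b x y → b * (x * y + (- y) * x) ≈ 0#
    cancel = solve 3 (λ b x y → b :* (x :* y :+ (:- y) :* x) := con (+ 0)) refl

    r-on-line = cross-≈0⇒parallel u₀ (r -ₚ z₀) u₀≠0
      (trans (cross-weighted u₀ z₀ p q Db≈1) (cancel b G H))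

  -- As in dimension one: if p satisfies all constraints but the first, then
  -- any two of the others are met on the boundary of the first, where the
  -- segment from p to a point of the triple leaves it; helly₁ applies there.
  helly₂ : ∀ {m} (z u : Fin m → Point) →
    (∀ i j l → ¬ ¬ (∃[ x ] Left (z i) (u i) x × Left (z j) (u j) x × Left (z l) (u l) x)) →
    ¬ ¬ (∃[ x ] ∀ i → Left (z i) (u i) x)
  helly₂ {ℕ.zero}  z u triples = return ((0# , 0#) , λ ())
  helly₂ {ℕ.suc m} z u triples = do
    (p , gᵢp≥0) ← helly₂ (λ i → z (suc i)) (λ i → u (suc i))
                    (λ i j l → triples (suc i) (suc j) (suc l))
    inj₂ g₀p<0 ← ≤-<-connex 0# (g zero p)
      where inj₁ g₀p≥0 → return (p , λ { zero → g₀p≥0 ; (suc i) → gᵢp≥0 i })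
    u₀≠0 ← cross-<0⇒nonZero (u zero) (p -ₚ z zero) g₀p<0
    (t , on-line) ← helly₁
      (λ i → cross (u (suc i)) (z zero -ₚ z (suc i)))
      (λ i → cross (u (suc i)) (u zero))
      (λ i j → do
        (q , g₀q≥0 , gᵢq≥0 , gⱼq≥0) ← triples zero (suc i) (suc j)
        (t , on-line) ← return (crossing-point (z zero) (u zero) p q u₀≠0 g₀p<0 g₀q≥0)
        return (t , on-line (z (suc i)) (u (suc i)) (gᵢp≥0 i) gᵢq≥0 , on-line (z (suc j)) (u (suc j)) (gᵢp≥0 j) gⱼq≥0))
    return (z zero +ₚ t ·ₚ u zero , λ
      { zero    → line-left-self (z zero) (u zero) t
      ; (suc i) → line-left (z zero) (u zero) t (z (suc i)) (u (suc i)) (on-line i)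
      })
    where
    g : Fin (ℕ.suc m) → Point → Carrier
    g i x = cross (u i) (x -ₚ z i)

-- Convex hulls, finite sums and cyclic indices.

module HullProperties {c ℓ₁ ℓ₂} (ℝ : RealNumbers c ℓ₁ ℓ₂) where
  open Plane ℝ
  open RealNumbers ℝ hiding (zero)
  open OrderedFieldProperties orderedField
  open PlaneProperties ℝ
  open import Algebra.Properties.CommutativeMonoid.Sum +-commutativeMonoid using (sum; sum-cong-≋)
  open IntegerSolver commutativeRing using (solve; _:=_; _:+_; _:-_; :-_; _:*_; con)

  sum-nonneg : ∀ {m} (f : Fin m → Carrier) → (∀ i → 0# ≤ f i) → 0# ≤ sum f
  sum-nonneg {ℕ.zero}  f 0≤f = ≈⇒≤ refl
  sum-nonneg {ℕ.suc m} f 0≤f = 0≤x+y (0≤f zero) (sum-nonneg (λ i → f (suc i)) (λ i → 0≤f (suc i)))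

  sum-affine : ∀ {m} α β γ (w x y : Fin m → Carrier) →
    sum (λ i → w i * (α * x i + β * y i + γ))
    ≈ α * sum (λ i → w i * x i) + β * sum (λ i → w i * y i) + γ * sum w
  sum-affine {ℕ.zero}  α β γ w x y =
    solve 3 (λ α β γ → con (+ 0) := α :* con (+ 0) :+ β :* con (+ 0) :+ γ :* con (+ 0)) refl α β γ
  sum-affine {ℕ.suc m} α β γ w x y = trans
    (+-congˡ (sum-affine α β γ (λ i → w (suc i)) (λ i → x (suc i)) (λ i → y (suc i))))
    (step α β γ (w zero) (x zero) (y zero) _ _ _)
    where
    step : ∀ α β γ w x y X Y W → w * (α * x + β * y + γ) + (α * X + β * Y + γ * W)
      ≈ α * (w * x + X) + β * (w * y + Y) + γ * (w + W)
    step = solve 9 (λ α β γ w x y X Y W → w :* (α :* x :+ β :* y :+ γ) :+ (α :* X :+ β :* Y :+ γ :* W)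
      := α :* (w :* x :+ X) :+ β :* (w :* y :+ Y) :+ γ :* (w :+ W)) refl

  -- The value at a convex combination is the same combination of the values at the points; the
  -- constant term survives because the weights add up to one.
  hull-affine-nonneg : ∀ {m} (v : Fin m → Point) α β γ →
    (∀ i → 0# ≤ α * proj₁ (v i) + β * proj₂ (v i) + γ) →
    ∀ {x} → ConvexHull v x → 0# ≤ α * proj₁ x + β * proj₂ x + γ
  hull-affine-nonneg v α β γ 0≤v {x₁ , x₂} (w , 0≤w , ∑w≈1 , x₁≈ , x₂≈) = 0≤-resp-≈
    (trans (sum-affine α β γ w (λ i → proj₁ (v i)) (λ i → proj₂ (v i)))
      (+-cong (+-cong (*-congˡ (sym x₁≈)) (*-congˡ (sym x₂≈)))
              (trans (*-congˡ ∑w≈1) (*-identityʳ γ))))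
    (sum-nonneg _ (λ i → 0≤x*y (0≤w i) (0≤v i)))

  hull-cross-≥ : ∀ {m} (v : Fin m → Point) d e → (∀ i → e ≤ cross d (v i)) →
    ∀ {x} → ConvexHull v x → e ≤ cross d x
  hull-cross-≥ v (d₁ , d₂) e e≤v {x₁ , x₂} x∈hull = 0≤y-x⇒x≤y (0≤-resp-≈ (sym (shape x₁ x₂))
    (hull-affine-nonneg v (- d₂) d₁ (- e) (λ i → 0≤-resp-≈ (shape _ _) (x≤y⇒0≤y-x (e≤v i))) x∈hull))
    where
    shape : ∀ x₁ x₂ → (d₁ * x₂ - d₂ * x₁) - e ≈ (- d₂) * x₁ + d₁ * x₂ + (- e)
    shape x₁ x₂ = solve 5 (λ d₁ d₂ e x₁ x₂ →
      (d₁ :* x₂ :- d₂ :* x₁) :- e := (:- d₂) :* x₁ :+ d₁ :* x₂ :+ (:- e)) refl d₁ d₂ e x₁ x₂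

  hull-cross-≤ : ∀ {m} (v : Fin m → Point) d e → (∀ i → cross d (v i) ≤ e) →
    ∀ {x} → ConvexHull v x → cross d x ≤ e
  hull-cross-≤ v (d₁ , d₂) e v≤e {x₁ , x₂} x∈hull = 0≤y-x⇒x≤y (0≤-resp-≈ (sym (shape x₁ x₂))
    (hull-affine-nonneg v d₂ (- d₁) e (λ i → 0≤-resp-≈ (shape _ _) (x≤y⇒0≤y-x (v≤e i))) x∈hull))
    where
    shape : ∀ x₁ x₂ → e - (d₁ * x₂ - d₂ * x₁) ≈ d₂ * x₁ + (- d₁) * x₂ + e
    shape x₁ x₂ = solve 5 (λ d₁ d₂ e x₁ x₂ →
      e :- (d₁ :* x₂ :- d₂ :* x₁) := d₂ :* x₁ :+ (:- d₁) :* x₂ :+ e) refl d₁ d₂ e x₁ x₂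

  indicator : ∀ {m} → Fin m → Fin m → Carrier
  indicator zero    zero    = 1#
  indicator zero    (suc j) = 0#
  indicator (suc i) zero    = 0#
  indicator (suc i) (suc j) = indicator i j

  0≤indicator : ∀ {m} (i j : Fin m) → 0# ≤ indicator i j
  0≤indicator zero    zero    = 0≤1
  0≤indicator zero    (suc j) = ≈⇒≤ refl
  0≤indicator (suc i) zero    = ≈⇒≤ refl
  0≤indicator (suc i) (suc j) = 0≤indicator i j

  sum-zero-weights : ∀ {m} (f : Fin m → Carrier) → sum (λ i → 0# * f i) ≈ 0#
  sum-zero-weights {ℕ.zero}  f = refl
  sum-zero-weights {ℕ.suc m} f =
    trans (+-cong (zeroˡ _) (sum-zero-weights (λ i → f (suc i)))) (+-identityˡ 0#)

  sum-indicator : ∀ {m} (i : Fin m) f → sum (λ j → indicator i j * f j) ≈ f i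
  sum-indicator zero    f =
    trans (+-cong (*-identityˡ _) (sum-zero-weights (λ i → f (suc i)))) (+-identityʳ _)
  sum-indicator (suc i) f =
    trans (+-cong (zeroˡ _) (sum-indicator i (λ i → f (suc i)))) (+-identityˡ _)

  sum-combination : ∀ {m} a b c (u v w f : Fin m → Carrier) →
    sum (λ i → (a * u i + b * v i + c * w i) * f i)
    ≈ a * sum (λ i → u i * f i) + b * sum (λ i → v i * f i) + c * sum (λ i → w i * f i)
  sum-combination {ℕ.zero}  a b c u v w f =
    solve 3 (λ a b c → con (+ 0) := a :* con (+ 0) :+ b :* con (+ 0) :+ c :* con (+ 0)) refl a b c
  sum-combination {ℕ.suc m} a b c u v w f = trans
    (+-congˡ (sum-combination a b c (λ i → u (suc i)) (λ i → v (suc i)) (λ i → w (suc i)) (λ i → f (suc i))))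
    (step a b c (u zero) (v zero) (w zero) (f zero) _ _ _)
    where
    step : ∀ a b c u v w f U V W → (a * u + b * v + c * w) * f + (a * U + b * V + c * W)
      ≈ a * (u * f + U) + b * (v * f + V) + c * (w * f + W)
    step = solve 10 (λ a b c u v w f U V W → (a :* u :+ b :* v :+ c :* w) :* f :+ (a :* U :+ b :* V :+ c :* W)
      := a :* (u :* f :+ U) :+ b :* (v :* f :+ V) :+ c :* (w :* f :+ W)) refl

  -- The three coefficients become a weight on every index by adding scaled indicators, which stays
  -- correct if some of the indices coincide.
  triangle⊆hull : ∀ {m} (v : Fin m → Point) i j l {a b c x} →
    0# ≤ a → 0# ≤ b → 0# ≤ c → a + b + c ≈ 1# → x ≈ₚ (a ·ₚ v i +ₚ b ·ₚ v j) +ₚ c ·ₚ v l →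
    ConvexHull v x
  triangle⊆hull v i j l {a} {b} {c} 0≤a 0≤b 0≤c a+b+c≈1 (x₁≈ , x₂≈) =
    weights ,
    (λ k → 0≤x+y (0≤x+y (0≤x*y 0≤a (0≤indicator i k)) (0≤x*y 0≤b (0≤indicator j k))) (0≤x*y 0≤c (0≤indicator l k))) ,
    -- Summing the constant function one against the weights yields their total.
    trans (sum-cong-≋ (λ k → sym (*-identityʳ (weights k))))
      (trans (weighted (λ _ → 1#))
        (trans (+-cong (+-cong (*-identityʳ a) (*-identityʳ b)) (*-identityʳ c)) a+b+c≈1)) ,
    trans x₁≈ (sym (weighted (λ k → proj₁ (v k)))) ,
    trans x₂≈ (sym (weighted (λ k → proj₂ (v k))))
    where
    weights : Fin _ → Carrier
    weights k = a * indicator i k + b * indicator j k + c * indicator l k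

    weighted : ∀ f → sum (λ k → weights k * f k) ≈ a * f i + b * f j + c * f l
    weighted f = trans (sum-combination a b c (indicator i) (indicator j) (indicator l) f)
      (+-cong (+-cong (*-congˡ (sum-indicator i f)) (*-congˡ (sum-indicator j f))) (*-congˡ (sum-indicator l f)))

  -- A discrete intermediate value theorem: walk along the sequence until the next value is
  -- negative, or the end is reached.
  sign-change : ∀ {n} (d : Fin (2 ℕ.+ n) → Carrier) → 0# ≤ d zero → 0# ≤ - d (fromℕ (1 ℕ.+ n)) →
    ¬ ¬ (∃[ i ] 0# ≤ d (inject₁ i) × 0# ≤ - d (suc i))
  sign-change {ℕ.zero}  d 0≤d₀ dₙ≤0 = return (zero , 0≤d₀ , dₙ≤0)
  sign-change {ℕ.suc n} d 0≤d₀ dₙ≤0 = do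
    inj₁ 0≤d₁ ← ≤-<-connex 0# (d (suc zero))
      where inj₂ d₁<0 → return (zero , 0≤d₀ , <⇒≤ (x<0⇒0<-x d₁<0))
    (i , 0≤dᵢ , dᵢ₊₁≤0) ← sign-change (λ i → d (suc i)) 0≤d₁ dₙ≤0
    return (suc i , 0≤dᵢ , dᵢ₊₁≤0)

  next-inject₁ : ∀ {m} (i : Fin m) → next (inject₁ i) ≡ suc i
  next-inject₁ {m} i = toℕ-injective (≡.trans (toℕ-fromℕ< (m%n<n (ℕ.suc (toℕ (inject₁ i))) (ℕ.suc m)))
    (≡.trans (≡.cong (λ k → ℕ.suc k ℕ.% ℕ.suc m) (toℕ-inject₁ i)) (m<n⇒m%n≡m (ℕ.s<s (toℕ<n i)))))

  next-fromℕ : ∀ m → next (fromℕ m) ≡ zero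
  next-fromℕ m = toℕ-injective (≡.trans (toℕ-fromℕ< (m%n<n (ℕ.suc (toℕ (fromℕ m))) (ℕ.suc m)))
    (≡.trans (≡.cong (λ k → ℕ.suc k ℕ.% ℕ.suc m) (toℕ-fromℕ m)) (n%n≡0 (ℕ.suc m))))

-- A convex polygon as an intersection of half-planes.

module PolygonProperties {c ℓ₁ ℓ₂} (ℝ : RealNumbers c ℓ₁ ℓ₂) (P : Plane.Polygon ℝ) where
  open Plane ℝ
  open RealNumbers ℝ hiding (zero)
  open OrderedFieldProperties orderedField
  open PlaneProperties ℝ
  open HullProperties ℝ
  open IntegerSolver commutativeRing using (solve; _:=_; _:+_; _:-_; :-_; _:*_; con)
  open Polygon P

  -- `convex` leaves out the two endpoints of the side, where the cross product vanishes.
  vertex-left : ∀ i j → Left (vertex i) (side i) (vertex j)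
  vertex-left i j with j ≟ i | j ≟ next i
  ... | yes ≡.refl | _          = ≈⇒≤ (sym (trans (cross-- (side i) (vertex i) (vertex i)) (-‿inverseʳ _)))
  ... | no _       | yes ≡.refl = ≈⇒≤ (sym (cross-self (side i)))
  ... | no j≢i     | no j≢next  = <⇒≤ (convex i j j≢i j≢next)

  -- Up to a factor of two, these are signed areas: the triangles joining `x` to the three sides
  -- make up the triangle `o p q`.
  barycentric-sum : ∀ o p q x → cross (q -ₚ p) (x -ₚ p) + - cross (q -ₚ o) (x -ₚ o) + cross (p -ₚ o) (x -ₚ o)
    ≈ cross (q -ₚ p) (o -ₚ p)
  barycentric-sum (o₁ , o₂) (p₁ , p₂) (q₁ , q₂) (x₁ , x₂) = solve 8 (λ o₁ o₂ p₁ p₂ q₁ q₂ x₁ x₂ →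
    :cross (q₁ :- p₁) (q₂ :- p₂) (x₁ :- p₁) (x₂ :- p₂)
      :+ (:- :cross (q₁ :- o₁) (q₂ :- o₂) (x₁ :- o₁) (x₂ :- o₂))
      :+ :cross (p₁ :- o₁) (p₂ :- o₂) (x₁ :- o₁) (x₂ :- o₂)
    := :cross (q₁ :- p₁) (q₂ :- p₂) (o₁ :- p₁) (o₂ :- p₂)) refl o₁ o₂ p₁ p₂ q₁ q₂ x₁ x₂

  -- Cramer's rule for the barycentric coordinates of x in the triangle o p q.
  barycentric : ∀ o p q x →
    cross (q -ₚ p) (o -ₚ p) ·ₚ x ≈ₚ
      (cross (q -ₚ p) (x -ₚ p) ·ₚ o +ₚ (- cross (q -ₚ o) (x -ₚ o)) ·ₚ p) +ₚ cross (p -ₚ o) (x -ₚ o) ·ₚ q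
  barycentric (o₁ , o₂) (p₁ , p₂) (q₁ , q₂) (x₁ , x₂) =
    solve 8 (λ o₁ o₂ p₁ p₂ q₁ q₂ x₁ x₂ →
      :cross (q₁ :- p₁) (q₂ :- p₂) (o₁ :- p₁) (o₂ :- p₂) :* x₁ :=
        (:cross (q₁ :- p₁) (q₂ :- p₂) (x₁ :- p₁) (x₂ :- p₂) :* o₁
        :+ (:- :cross (q₁ :- o₁) (q₂ :- o₂) (x₁ :- o₁) (x₂ :- o₂)) :* p₁)
        :+ :cross (p₁ :- o₁) (p₂ :- o₂) (x₁ :- o₁) (x₂ :- o₂) :* q₁) refl o₁ o₂ p₁ p₂ q₁ q₂ x₁ x₂ ,
    solve 8 (λ o₁ o₂ p₁ p₂ q₁ q₂ x₁ x₂ →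
      :cross (q₁ :- p₁) (q₂ :- p₂) (o₁ :- p₁) (o₂ :- p₂) :* x₂ :=
        (:cross (q₁ :- p₁) (q₂ :- p₂) (x₁ :- p₁) (x₂ :- p₂) :* o₂
        :+ (:- :cross (q₁ :- o₁) (q₂ :- o₂) (x₁ :- o₁) (x₂ :- o₂)) :* p₂)
        :+ :cross (p₁ :- o₁) (p₂ :- o₂) (x₁ :- o₁) (x₂ :- o₂) :* q₂) refl o₁ o₂ p₁ p₂ q₁ q₂ x₁ x₂

  scaled-barycentric⇒inside : ∀ i j l {D a b c x} → 0# < D → 0# ≤ a → 0# ≤ b → 0# ≤ c →
    a + b + c ≈ D → D ·ₚ x ≈ₚ (a ·ₚ vertex i +ₚ b ·ₚ vertex j) +ₚ c ·ₚ vertex l → ⟦ P ⟧ x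
  scaled-barycentric⇒inside i j l {D} {a} {b} {c} 0<D 0≤a 0≤b 0≤c a+b+c≈D (eq₁ , eq₂)
    with e , 0≤e , De≈1 ← positive-inverse 0<D =
    triangle⊆hull vertex i j l (0≤x*y 0≤e 0≤a) (0≤x*y 0≤e 0≤b) (0≤x*y 0≤e 0≤c)
      (trans (factor e a b c) (trans (*-congˡ a+b+c≈D) (trans (*-comm e D) De≈1)))
      (rescale {e} De≈1 eq₁ , rescale {e} De≈1 eq₂)
    where
    factor : ∀ e a b c → e * a + e * b + e * c ≈ e * (a + b + c)
    factor = solve 4 (λ e a b c → e :* a :+ e :* b :+ e :* c := e :* (a :+ b :+ c)) refl

    rescale : ∀ {e x y z w} → D * e ≈ 1# → D * w ≈ (a * x + b * y) + c * z →
      w ≈ (e * a * x + e * b * y) + e * c * z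
    rescale {e} {x} {y} {z} {w} De≈1 eq = modulo (- w) De≈1 (modulo e eq
      (solve 9 (λ D e a b c x y z w →
        w := ((e :* a :* x :+ e :* b :* y) :+ e :* c :* z
              :+ (:- w) :* (D :* e :- con (+ 1))) :+ e :* (D :* w :- ((a :* x :+ b :* y) :+ c :* z)))
        refl D e a b c x y z w))

  in-triangle : ∀ i j l x → let o = vertex i ; p = vertex j ; q = vertex l in
    0# < cross (q -ₚ p) (o -ₚ p) →
    0# ≤ cross (q -ₚ p) (x -ₚ p) → 0# ≤ - cross (q -ₚ o) (x -ₚ o) → 0# ≤ cross (p -ₚ o) (x -ₚ o) →
    ⟦ P ⟧ x
  in-triangle i j l x 0<D 0≤a 0≤b 0≤c = scaled-barycentric⇒inside i j l 0<D 0≤a 0≤b 0≤c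
    (barycentric-sum (vertex i) (vertex j) (vertex l) x)
    (barycentric (vertex i) (vertex j) (vertex l) x)

  -- Fan triangulation from vertex zero: x lies in the triangle on the two
  -- consecutive vertices between which the ray from vertex zero to x passes.
  left-of-sides⇒inside : ∀ {x} → (∀ i → Left (vertex i) (side i) x) → ¬ ¬ ⟦ P ⟧ x
  left-of-sides⇒inside {x} left = do
    -- The end values of `d` come from the two sides at vertex zero: one starts there, the other
    -- ends there and is read backwards.
    (i , 0≤dᵢ , dᵢ₊₁≤0) ← sign-change d
      (≡.subst (λ k → 0# ≤ cross (vertex k -ₚ o) (x -ₚ o)) (next-inject₁ zero) (left zero))
      (0≤-resp-≈ (reverse (vertex last))
        (≡.subst (λ k → 0# ≤ cross (vertex k -ₚ vertex last) (x -ₚ vertex last)) (next-fromℕ (2 ℕ.+ size-3)) (left last)))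
    let next-i : next (suc (inject₁ i)) ≡ suc (suc i)
        next-i = next-inject₁ (suc i)
        p      = vertex (suc (inject₁ i))
    return (in-triangle zero (suc (inject₁ i)) (suc (suc i)) x
      (≡.subst (λ k → 0# < cross (vertex k -ₚ p) (o -ₚ p)) next-i
        -- Vertex zero is no endpoint of the far side of the fan triangle, so the triangle is
        -- nondegenerate.
        (convex (suc (inject₁ i)) zero (λ ())
          (λ 0≡next → contradiction (≡.trans 0≡next next-i) λ ())))
      (≡.subst (λ k → 0# ≤ cross (vertex k -ₚ p) (x -ₚ p)) next-i (left (suc (inject₁ i))))
      dᵢ₊₁≤0 0≤dᵢ)
    where
    o    = vertex zero
    last = fromℕ (2 ℕ.+ size-3)

    d : Fin (2 ℕ.+ size-3) → Carrier
    d i = cross (vertex (suc i) -ₚ o) (x -ₚ o)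

    reverse : ∀ l → cross (o -ₚ l) (x -ₚ l) ≈ - cross (l -ₚ o) (x -ₚ o)
    reverse (l₁ , l₂) = let (o₁ , o₂) = o ; (x₁ , x₂) = x in solve 6 (λ o₁ o₂ l₁ l₂ x₁ x₂ →
      :cross (o₁ :- l₁) (o₂ :- l₂) (x₁ :- l₁) (x₂ :- l₂)
      := :- :cross (l₁ :- o₁) (l₂ :- o₂) (x₁ :- o₁) (x₂ :- o₂)) refl o₁ o₂ l₁ l₂ x₁ x₂

-- Homothetic copies of the polygon.

module Homothets {c ℓ₁ ℓ₂} (ℝ : RealNumbers c ℓ₁ ℓ₂) (P : Plane.Polygon ℝ)
  {i} {I : Set i}
  (scale : I → RealNumbers.Carrier ℝ) (0<scale : ∀ a → RealNumbers._<_ ℝ (RealNumbers.0# ℝ) (scale a))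
  (shift : I → Plane.Point ℝ)
  where
  open Plane ℝ
  open RealNumbers ℝ hiding (zero)
  open OrderedFieldProperties orderedField
  open PlaneProperties ℝ
  open HullProperties ℝ
  open PolygonProperties ℝ P
  open IntegerSolver commutativeRing using (solve; _:=_; _:+_; _:-_; :-_; _:*_; con)
  open Polygon P

  place : I → Point → Point
  place a x = scale a ·ₚ x +ₚ shift a

  corner : I → Fin size → Point
  corner a i = place a (vertex i)

  cross-place-diff : ∀ u a x y → cross u (place a y -ₚ place a x) ≈ scale a * cross u (y -ₚ x)
  cross-place-diff u a x y = trans
    (cross-congʳ u (lemma _ _ _ _ , lemma _ _ _ _))
    (cross-·ʳ u (scale a) (y -ₚ x))
    where
    lemma : ∀ s t x y → (s * y + t) - (s * x + t) ≈ s * (y - x)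
    lemma = solve 4 (λ s t x y → (s :* y :+ t) :- (s :* x :+ t) := s :* (y :- x)) refl

  place-left : ∀ a u x y → Left x u y → Left (place a x) u (place a y)
  place-left a u x y left = 0≤-resp-≈ (sym (cross-place-diff u a x y)) (0≤x*y (<⇒≤ (0<scale a)) left)

  place-cross-≤ : ∀ d a x y → cross d x ≤ cross d y → cross d (place a x) ≤ cross d (place a y)
  place-cross-≤ d a x y x≤y = 0≤y-x⇒x≤y (0≤-resp-≈ (cross-- d (place a y) (place a x))
    (place-left a d x y (0≤-resp-≈ (sym (cross-- d y x)) (x≤y⇒0≤y-x x≤y))))

  -- The inverse homothety multiplies each cross product by `b ≥ 0`, so the preimage of `x`
  -- satisfies the constraints of `P` itself.
  left-of-sides⇒placed : ∀ a {x} → (∀ i → Left (corner a i) (side i) x) →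
    ¬ ¬ (∃[ y ] ⟦ P ⟧ y × x ≈ₚ place a y)
  left-of-sides⇒placed a {x} left = do
    (b , 0≤b , sb≈1) ← return (positive-inverse (0<scale a))
    y∈P ← left-of-sides⇒inside (λ i →
      0≤-resp-≈ (sym (trans
        (cross-congʳ (side i) (unplace-diff sb≈1 _ _ _ , unplace-diff sb≈1 _ _ _))
        (cross-·ʳ (side i) b (x -ₚ corner a i))))
      (0≤x*y 0≤b (left i)))
    return (b ·ₚ (x -ₚ shift a) , y∈P , place-unplace sb≈1 _ _ , place-unplace sb≈1 _ _)
    where
    unplace-diff : ∀ {s b} → s * b ≈ 1# → ∀ x t v → b * (x - t) - v ≈ b * (x - (s * v + t))
    unplace-diff {s} {b} sb≈1 x t v = modulo v sb≈1 (solve 5 (λ s b x t v →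
      b :* (x :- t) :- v := b :* (x :- (s :* v :+ t)) :+ v :* (s :* b :- con (+ 1))) refl s b x t v)

    place-unplace : ∀ {s b} → s * b ≈ 1# → ∀ x t → x ≈ s * (b * (x - t)) + t
    place-unplace {s} {b} sb≈1 x t = modulo (t - x) sb≈1 (solve 4 (λ s b x t →
      x := (s :* (b :* (x :- t)) :+ t) :+ (t :- x) :* (s :* b :- con (+ 1))) refl s b x t)

  -- Projections along the side directions, and when two copies meet.

  module Projections {k} (line : Fin k → Line)
    (parallel : ∀ i → ∃[ j ] ⟦ line j ⟧ˡ (side i))
    (lowest highest : Fin k → Fin size)
    (lowest-≤ : ∀ j i → cross (Line.direction (line j)) (vertex (lowest j)) ≤ cross (Line.direction (line j)) (vertex i))
    (highest-≥ : ∀ j i → cross (Line.direction (line j)) (vertex i) ≤ cross (Line.direction (line j)) (vertex (highest j)))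
    where

    direction : Fin k → Point
    direction j = Line.direction (line j)

    -- `cross (direction j)` is constant along line `j`, so it is the coordinate of the projection.
    -- As scales are positive, the same two vertices of `P` are extreme in every copy.
    lo hi : Fin k → I → Carrier
    lo j a = cross (direction j) (corner a (lowest j))
    hi j a = cross (direction j) (corner a (highest j))

    lo≤hi : ∀ j a → lo j a ≤ hi j a
    lo≤hi j a = place-cross-≤ (direction j) a _ _ (lowest-≤ j (highest j))

    -- The coordinate of the common point lies between the two ends.
    meet⇒lo≤hi : ∀ {a b x y} → ⟦ P ⟧ x → ⟦ P ⟧ y → place a x ≈ₚ place b y → ∀ j → lo j a ≤ hi j b
    meet⇒lo≤hi {a} {b} {x} {y} x∈P y∈P ax≈by j = ≤-trans
      (place-cross-≤ (direction j) a _ _ (hull-cross-≥ vertex (direction j) _ (lowest-≤ j) x∈P))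
      (≤-trans (≈⇒≤ (cross-congʳ (direction j) ax≈by))
        (place-cross-≤ (direction j) b _ _ (hull-cross-≤ vertex (direction j) _ (highest-≥ j) y∈P)))

    module _ {a b} (a≤b : ∀ j → lo j a ≤ hi j b) (b≤a : ∀ j → lo j b ≤ hi j a) where

      -- Side l is t d for the direction d of some line; the sign of t decides
      -- which corner of the copy a, lowest or highest for d, reaches furthest.
      corner-left : ∀ l → ¬ ¬ (∃[ w ] Left (corner b l) (side l) (corner a w))
      corner-left l = do
        (j , d×u≈0) ← return (parallel l)
        (t , u≈td) ← return (cross-≈0⇒parallel (direction j) (side l) (Line.nonzero (line j)) d×u≈0)
        inj₁ 0≤t ← ≤-<-connex 0# t
          where
            inj₂ t<0 → return (lowest j ,
              via (highest j) t u≈td (0≤-resp-≈ (flip t _ _)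
                (0≤x*y (<⇒≤ (x<0⇒0<-x t<0)) (x≤y⇒0≤y-x (a≤b j)))))
        return (highest j , via (lowest j) t u≈td (0≤x*y 0≤t (x≤y⇒0≤y-x (b≤a j))))
        where
        flip : ∀ t x y → (- t) * (y - x) ≈ t * (x - y)
        flip = solve 3 (λ t x y → (:- t) :* (y :- x) := t :* (x :- y)) refl

        -- The displacement from `corner b l` to `corner a w` is split at `corner b v`. The part
        -- within copy `b` points left by convexity; the part between the copies is the gap assumed
        -- nonnegative.
        via : ∀ v {w d} t → side l ≈ₚ t ·ₚ d → 0# ≤ t * (cross d (corner a w) - cross d (corner b v)) →
          Left (corner b l) (side l) (corner a w)
        via v {w} {d} t u≈td 0≤ = 0≤-resp-≈
          (sym (trans (cross-congʳ (side l) (-ₚ-telescope (corner a w) (corner b v) (corner b l)))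
                      (cross-+ (side l) _ _)))
          (0≤x+y
            (0≤-resp-≈ (sym (trans (cross-congˡ (corner a w -ₚ corner b v) u≈td)
                         (trans (cross-·ˡ t d _) (*-congˡ (cross-- d (corner a w) (corner b v))))))
              0≤)
            (place-left b (side l) (vertex l) (vertex v) (vertex-left l v)))

    lo≤hi⇒meet : ∀ a b → (∀ j → lo j a ≤ hi j b) → (∀ j → lo j b ≤ hi j a) →
      ¬ ¬ (∃[ x ] (∃[ y ] ⟦ P ⟧ y × x ≈ₚ place a y) × (∃[ y ] ⟦ P ⟧ y × x ≈ₚ place b y))
    lo≤hi⇒meet a b a≤b b≤a = do
      -- The half-planes of both copies form one family; `remQuot` splits an index into copy and
      -- side.
      (x , left) ← helly₂ (λ n → uncurry boundary (remQuot size n)) (λ n → side (proj₂ (remQuot {2} size n)))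
        (λ m n o → triple (remQuot size m) (remQuot size n) (remQuot size o))
      let left′ : ∀ e i → Left (boundary e i) (side i) x
          left′ e i = ≡.subst (λ ei → Left (uncurry boundary ei) (side (proj₂ ei)) x)
            (remQuot-combine e i) (left (combine e i))
      xa ← left-of-sides⇒placed a (left′ 0F)
      xb ← left-of-sides⇒placed b (left′ 1F)
      return (x , xa , xb)
      where
      copy : Fin 2 → I
      copy 0F = a
      copy 1F = b

      boundary : Fin 2 → Fin size → Point
      boundary e = corner (copy e)

      overlaps : ∀ e f j → lo j (copy e) ≤ hi j (copy f)
      overlaps 0F 0F j = lo≤hi j a
      overlaps 0F 1F j = a≤b j
      overlaps 1F 0F j = b≤a j
      overlaps 1F 1F j = lo≤hi j b

      Sat : Fin 2 × Fin size → Point → Set ℓ₂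
      Sat (e , i) = Left (boundary e i) (side i)

      -- A corner of copy `e` satisfies all constraints of that copy, and `corner-left` selects one
      -- that also reaches the extra half-plane.
      all-but-one : ∀ e n → ¬ ¬ (∃[ x ] (∀ i → Sat (e , i) x) × Sat n x)
      all-but-one e (f , l) = do
        (w , left) ← corner-left {copy e} {copy f} (overlaps e f) (overlaps f e) l
        return (corner (copy e) w , (λ i → place-left (copy e) (side i) (vertex i) (vertex w) (vertex-left i w)) , left)

      pigeonhole : ∀ (e f g : Fin 2) → e ≡ f ⊎ e ≡ g ⊎ f ≡ g
      pigeonhole 0F 0F _  = inj₁ ≡.refl
      pigeonhole 0F 1F 0F = inj₂ (inj₁ ≡.refl)
      pigeonhole 0F 1F 1F = inj₂ (inj₂ ≡.refl)
      pigeonhole 1F 0F 0F = inj₂ (inj₂ ≡.refl)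
      pigeonhole 1F 0F 1F = inj₂ (inj₁ ≡.refl)
      pigeonhole 1F 1F _  = inj₁ ≡.refl

      triple : ∀ m n o → ¬ ¬ (∃[ x ] Sat m x × Sat n x × Sat o x)
      triple (e , i) (f , j) (g , l) with pigeonhole e f g
      ... | inj₁ ≡.refl = do
        (x , all , one) ← all-but-one e (g , l)
        return (x , all i , all j , one)
      ... | inj₂ (inj₁ ≡.refl) = do
        (x , all , one) ← all-but-one e (f , j)
        return (x , all i , one , all l)
      ... | inj₂ (inj₂ ≡.refl) = do
        (x , all , one) ← all-but-one f (e , i)
        return (x , one , all j , all l)

-- Maximal cliques in intersection graphs of boxes.

lookup-injective : {xs : List A} → Unique xs → ∀ {i j} → lookup xs i ≡ lookup xs j → i ≡ j
lookup-injective (_ ∷ _)      {zero}  {zero}  _  = ≡.refl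
lookup-injective (x∉xs ∷ _)   {zero}  {suc j} eq = contradiction eq (All.lookup x∉xs (∈-lookup j))
lookup-injective (x∉xs ∷ _)   {suc i} {zero}  eq = contradiction (≡.sym eq) (All.lookup x∉xs (∈-lookup i))
lookup-injective (_ ∷ unique) {suc i} {suc j} eq = ≡.cong suc (lookup-injective unique eq)

-- The empty clique is never maximal, since a singleton extends it. Hence every maximal clique has a
-- member with largest lower end.
maximalClique-nonempty : ∀ {n a} .{{_ : ℕ.NonZero n}} (G : Graph n a) {C} → MaximalClique G C → Nonempty C
maximalClique-nonempty {n = ℕ.suc n} G {C} (_ , maximal) with nonempty? C
... | yes nonempty = nonempty
... | no empty     = zero , ≡.subst (zero ∈_) (≡.sym C≡⁅0⁆) (x∈⁅x⁆ zero)
  where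
  C≡⁅0⁆ : C ≡ ⁅ zero ⁆
  C≡⁅0⁆ = maximal ⁅ zero ⁆
    (λ i j i∈ j∈ i≢j → contradiction (≡.trans (x∈⁅y⁆⇒x≡y zero i∈) (≡.sym (x∈⁅y⁆⇒x≡y zero j∈))) i≢j)
    (λ x∈C → contradiction (_ , x∈C) empty)

module BoxRepresentations {c ℓ₁ ℓ₂} (F : OrderedField c ℓ₁ ℓ₂) where
  open OrderedField F hiding (zero)
  open OrderedFieldProperties F

  maximum : ∀ {n} (C : Subset n) (f : Fin n → Carrier) → Nonempty C →
    ¬ ¬ (∃[ i ] i ∈ C × (∀ j → j ∈ C → f j ≤ f i))
  maximum (outside ∷ C) f (suc i , there i∈C) = do
    (m , m∈C , f≤fm) ← maximum C (λ i → f (suc i)) (i , i∈C)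
    return (suc m , there m∈C , λ { (suc j) (there j∈C) → f≤fm j j∈C })
  maximum (inside ∷ C) f _ with nonempty? C
  ... | no empty = return (zero , here , λ
    { zero    _           → ≈⇒≤ refl
    ; (suc j) (there j∈C) → contradiction (j , j∈C) empty })
  ... | yes nonempty = do
    (m , m∈C , f≤fm) ← maximum C (λ i → f (suc i)) nonempty
    inj₁ f₀≤fm ← ≤-<-connex (f zero) (f (suc m))
      where inj₂ fm<f₀ → return (zero , here , λ
              { zero    _           → ≈⇒≤ refl
              ; (suc j) (there j∈C) → ≤-trans (f≤fm j j∈C) (<⇒≤ fm<f₀) })
    return (suc m , there m∈C , λ
      { zero    _           → f₀≤fm
      ; (suc j) (there j∈C) → f≤fm j j∈C })

  module _ {n a k} .{{_ : ℕ.NonZero n}} (G : Graph n a) (lo hi : Fin k → Fin n → Carrier)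
    (lo≤hi : ∀ c i → lo c i ≤ hi c i)
    (adjacent⇒overlap : ∀ {i j} → i ≢ j → Graph.Adj G i j → ∀ c → lo c i ≤ hi c j)
    (overlap⇒adjacent : ∀ {i j} → i ≢ j → (∀ c → lo c i ≤ hi c j) → (∀ c → lo c j ≤ hi c i) →
      ¬ ¬ Graph.Adj G i j)
    where
    open Graph G using (Adj)

    -- A relation rather than a function: ties allow several choices, and existence is known only
    -- under double negation.
    IsTop : Subset n → (Fin k → Fin n) → Set ℓ₂
    IsTop C m = ∀ c → m c ∈ C × (∀ j → j ∈ C → lo c j ≤ lo c (m c))

    -- The case `i ≡ j` is included because a top member is also compared with itself.
    clique-overlap : ∀ {C} → Clique G C → ∀ {i j} → i ∈ C → j ∈ C → ∀ c → lo c i ≤ hi c j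
    clique-overlap clique {i} {j} i∈C j∈C c with i ≟ j
    ... | yes ≡.refl = lo≤hi c i
    ... | no i≢j     = adjacent⇒overlap i≢j (clique i j i∈C j∈C i≢j) c

    -- The largest lower ends of C lie in all intervals of C, so if they are
    -- shared by D, then C ∪ D is a clique.
    same-top⇒≡ : (∀ i j → Dec (Adj i j)) → ∀ {C D m} →
      MaximalClique G C → MaximalClique G D → IsTop C m → IsTop D m → C ≡ D
    same-top⇒≡ adj? {C} {D} {m} (cliqueC , maximalC) (cliqueD , maximalD) topC topD =
      ≡.trans (maximalC (C ∪ D) clique (p⊆p∪q D)) (≡.sym (maximalD (C ∪ D) clique (q⊆p∪q C D)))
      where
      below : ∀ {i} → i ∈ C ∪ D → ∀ c → lo c i ≤ lo c (m c)
      below {i} i∈ c = [ proj₂ (topC c) i , proj₂ (topD c) i ]′ (x∈p∪q⁻ C D i∈)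

      above : ∀ {i} → i ∈ C ∪ D → ∀ c → lo c (m c) ≤ hi c i
      above i∈ c = [ (λ i∈C → clique-overlap cliqueC (proj₁ (topC c)) i∈C c)
                   , (λ i∈D → clique-overlap cliqueD (proj₁ (topD c)) i∈D c) ]′ (x∈p∪q⁻ C D i∈)

      clique : Clique G (C ∪ D)
      -- The largest lower end in each coordinate separates the lower end of one box from the upper
      -- end of the other, in both directions.
      clique i j i∈ j∈ i≢j = decidable-stable (adj? i j) (overlap⇒adjacent i≢j
        (λ c → ≤-trans (below i∈ c) (above j∈ c)) (λ c → ≤-trans (below j∈ c) (above i∈ c)))

    -- Functions from coordinates to vertices are coded by `Fin (n ^ k)`; sending each clique to the
    -- code of its top members is injective.
    maximalCliques-≤ : (Cs : List (Subset n)) → Unique Cs → All (MaximalClique G) Cs →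
      length Cs ℕ.≤ n ℕ.^ k
    maximalCliques-≤ Cs unique maximal = decidable-stable (length Cs ℕ.≤? n ℕ.^ k) do
      adj? ← ¬¬-sequence (λ i → ¬¬-sequence (λ j → em (Adj i j)))
      tops ← ¬¬-sequence (λ x → ¬¬-sequence (λ c →
        maximum (lookup Cs x) (lo c) (maximalClique-nonempty G (maximalAt x))))
      let m : Fin (length Cs) → Fin k → Fin n
          m x c = proj₁ (tops x c)
      return (injective⇒≤ {f = λ x → funToFin (m x)} (λ {x} {y} eq → lookup-injective unique
        (same-top⇒≡ adj? (maximalAt x) (maximalAt y) (λ c → proj₂ (tops x c))
          -- Decoding the equal codes shows that the top members chosen for `x` are also top for
          -- `y`.
          (λ c → ≡.subst (λ i → i ∈ lookup Cs y × (∀ j → j ∈ lookup Cs y → lo c j ≤ lo c i))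
            (≡.trans (≡.sym (finToFun-funToFin (m y) c))
              (≡.trans (≡.cong (λ z → finToFun z c) (≡.sym eq)) (finToFun-funToFin (m x) c)))
            (proj₂ (tops y c))))))
      where
      maximalAt : ∀ x → MaximalClique G (lookup Cs x)
      maximalAt x = All.lookup maximal (∈-lookup x)

-- The clique bound for homothets of a polygon.

open import Data.Nat.Base using (NonZero; _≤_; _^_)

corollary1 : ∀ {c ℓ₁ ℓ₂ a} (ℝ : RealNumbers c ℓ₁ ℓ₂)
    (k : ℕ) .{{_ : NonZero k}} (P : Plane.Polygon ℝ) → Plane.𝒫 ℝ k P →
    (n : ℕ) .{{_ : NonZero n}} (G : Graph n a) → Pₕₒₘ ℝ P G →
    (Cs : List (Subset n)) → Unique Cs → All (MaximalClique G) Cs →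
    length Cs ≤ n ^ k
corollary1 ℝ k P (line , _ , parallel) n G (S , homothetic , intersection) Cs unique maximal =
  decidable-stable (length Cs ℕ.≤? n ^ k) do
    highest ← ¬¬-sequence (λ j → maximum ⊤ (height j) (zero , ∈⊤))
    -- A lowest vertex maximises the negated height.
    lowest  ← ¬¬-sequence (λ j → maximum ⊤ (λ i → - height j i) (zero , ∈⊤))
    return (bound (λ j → proj₁ (lowest j)) (λ j → proj₁ (highest j))
      (λ j i → neg-cancel-≤ (proj₂ (proj₂ (lowest j)) i ∈⊤))
      (λ j i → proj₂ (proj₂ (highest j)) i ∈⊤))
  where
  open Plane ℝ
  open RealNumbers ℝ using (Carrier; -_; 0#; _<_; sym; trans; orderedField) renaming (_≤_ to _≤ᴿ_)
  open OrderedFieldProperties orderedField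
  open BoxRepresentations orderedField
  open Polygon P

  scale : Fin n → Carrier
  scale i = proj₁ (homothetic i)

  shift : Fin n → Point
  shift i = proj₁ (proj₂ (homothetic i))

  0<scale : ∀ i → 0# < scale i
  0<scale i = proj₁ (proj₂ (proj₂ (homothetic i)))

  open Homothets ℝ P scale 0<scale shift

  S⊆placed : ∀ i {x} → S i x → ∃[ y ] ⟦ P ⟧ y × x ≈ₚ place i y
  S⊆placed i = proj₁ (proj₂ (proj₂ (proj₂ (homothetic i))))

  placed⊆S : ∀ i {x} → ∃[ y ] ⟦ P ⟧ y × x ≈ₚ place i y → S i x
  placed⊆S i = proj₂ (proj₂ (proj₂ (proj₂ (homothetic i))))

  height : Fin k → Fin size → Carrier
  height j i = cross (Line.direction (line j)) (vertex i)

  -- The extreme vertices exist only under double negation, so the box representation takes them as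
  -- arguments.
  bound : (lowest highest : Fin k → Fin size) →
    (∀ j i → height j (lowest j) ≤ᴿ height j i) → (∀ j i → height j i ≤ᴿ height j (highest j)) →
    length Cs ≤ n ^ k
  bound lowest highest lowest-≤ highest-≥ =
    maximalCliques-≤ G lo hi lo≤hi
      (λ {i} {j} i≢j adjacent → meet⇒overlap (Equivalence.to (intersection i j i≢j) adjacent))
      (λ {i} {j} i≢j i≤j j≤i → ¬¬-map
        (λ { (x , x∈i , x∈j) → Equivalence.from (intersection i j i≢j) (x , placed⊆S i x∈i , placed⊆S j x∈j) })
        (lo≤hi⇒meet i j i≤j j≤i))
      Cs unique maximal
    where
    open Projections line parallel lowest highest lowest-≤ highest-≥

    meet⇒overlap : ∀ {i j} → S i ≬ S j → ∀ c → lo c i ≤ᴿ hi c j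
    meet⇒overlap {i} {j} (x , x∈Sᵢ , x∈Sⱼ)
      with (y , y∈P , x≈y₁ , x≈y₂) ← S⊆placed i x∈Sᵢ | (z , z∈P , x≈z₁ , x≈z₂) ← S⊆placed j x∈Sⱼ =
      meet⇒lo≤hi y∈P z∈P (trans (sym x≈y₁) x≈z₁ , trans (sym x≈y₂) x≈z₂)
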